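{- Let $\alpha$ be any positive real and let $r\geq 6$ be any integer. Let $A(\alpha,r)$ be an algorithm solving distance-constrained exploration for all instances of $\mathcal{I}(\alpha,r)$. Then for every integer $k>1$ there exists an instance $(G=(V,E),l_s,\alpha)$ of $\mathcal{I}(\alpha,r)$ such that $|V|\geq k$ and for which the penalty of $A$ is at least $$\left(\frac{|V|}{16\left(2\left\lfloor(1+\alpha)r\right\rfloor+3\right)}\right)^2 .$$
   Context: Model. A mobile agent explores a finite, simple, undirected, connected graph $G=(V,E)$ starting from a source node $s$. Nodes have pairwise distinct integer labels; at each node $v$ the incident edges carry distinct local port numbers $0,\dots,\deg(v)-1$, with no relation between the two ports of an edge. Initially the agent knows only the label and degree of $s$. It runs a deterministic algorithm: at each step the algorithm, based on everything memorized so far, chooses a port at the current node and the agent traverses the corresponding edge; on arrival it learns the label and degree of the new node and the incoming port number. The agent has unbounded memory. Exploration requires traversing every edge (hence visiting every node) at least once. Distance-constrained exploration: let $r$ be the eccentricity of $s$ in $G$ and $\alpha>0$ a real constant, and let $D=(1+\alpha)r$. At every moment the agent must know a path of length at most $D$ (i.e. a sequence of at most $D$ edges already traversed by the agent) from its current node to $s$. Both $\alpha$ and $r$ are given to the algorithm in advance. An instance is a tuple $(G,l_s,\alpha)$ where $l_s$ is the label of $s$; $\mathcal{I}(\alpha,r)$ denotes the set of all instances $(G,l_s,\alpha)$ in which the eccentricity of the node labeled $l_s$ is $r$. An algorithm $A(\alpha,r)$ solves the problem for all instances of $\mathcal{I}(\alpha,r)$ if on each such instance it explores the whole graph while always respecting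 the distance constraint, and terminates. The penalty of an algorithm on an instance with graph $G=(V,E)$ is the number of edge traversals it performs in excess of $|E|$. -}

module Defs where

open import Data.Nat using (ℕ; zero; suc; _+_; _*_; _∸_; _≤_; _<?_; _/_)
open import Data.Fin using (Fin; toℕ; fromℕ<)
open import Data.Integer using (ℤ)
open import Data.Product using (Σ; ∃; _×_; _,_; proj₁; proj₂)
open import Data.Sum using (_⊎_)
open import Data.Unit using (⊤)
open import Data.List using (List; []; _∷_; _++_; [_]; length; map; allFin)
open import Data.Nat.ListAction using (sum)
open import Data.List.Relation.Unary.Any using (Any)
open import Data.Maybe using (Maybe; just; nothing)
open import Relation.Binary.PropositionalEquality using (_≡_)
open import Relation.Nullary using (¬_; yes; no)
open import Function.Definitions using (Injective)

-- Finite simple undirected graphs with integer node labels and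
-- local port numbers.  Nodes are Fin n; at node v the ports are
-- Fin (deg v) (i.e. 0 .. deg v - 1); nbr v p is the other endpoint of
-- the edge at port p of v, and back v p is the port number of that
-- same edge at the other endpoint (no relation imposed between p and
-- back v p).  Simplicity: no loops, no multiple edges.

record PortGraph : Set where
  field
    n            : ℕ
    deg          : Fin n → ℕ
    nbr          : (v : Fin n) → Fin (deg v) → Fin n
    back         : (v : Fin n) (p : Fin (deg v)) → Fin (deg (nbr v p))
    back-correct : ∀ v p → nbr (nbr v p) (back v p) ≡ v
    loopless     : ∀ v p → ¬ (nbr v p ≡ v)
    no-multi     : ∀ v → Injective _≡_ _≡_ (nbr v)
    label        : Fin n → ℤ
    label-inj    : Injective _≡_ _≡_ label

open PortGraph public

module _ (G : PortGraph) where

  data Walk (ok : (v : Fin (n G)) → Fin (deg G v) → Set)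
            : Fin (n G) → Fin (n G) → ℕ → Set where
    []  : ∀ {v} → Walk ok v v 0
    _∷_ : ∀ {u v ℓ} (p : Fin (deg G u)) → ok u p →
          Walk ok (nbr G u p) v ℓ → Walk ok u v (suc ℓ)

  anyEdge : (v : Fin (n G)) → Fin (deg G v) → Set
  anyEdge _ _ = ⊤

  Connected : Set
  Connected = ∀ u v → ∃ λ ℓ → Walk anyEdge u v ℓ

  Eccentricity : Fin (n G) → ℕ → Set
  Eccentricity s r =
      (∀ v → ∃ λ ℓ → ℓ ≤ r × Walk anyEdge s v ℓ)
    × (∃ λ v → ∀ ℓ → Walk anyEdge s v ℓ → r ≤ ℓ)

  -- |E| : every edge is seen from exactly two ports (handshake lemma)
  numEdges : ℕ
  numEdges = sum (map (deg G) (allFin (n G))) / 2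

  DirEdge : Set
  DirEdge = Σ (Fin (n G)) λ v → Fin (deg G v)

  Traversed : List DirEdge → (u : Fin (n G)) → Fin (deg G u) → Set
  Traversed tr u p = Any (λ e →
      (proj₁ e ≡ u × nbr G (proj₁ e) (proj₂ e) ≡ nbr G u p)
    ⊎ (proj₁ e ≡ nbr G u p × nbr G (proj₁ e) (proj₂ e) ≡ u)) tr

-- Deterministic agents with unbounded memory.
-- Observation at start: (label, degree) of s.
-- Each move yields a record (port taken, label of arrival node,
-- degree of arrival node, incoming port).  The algorithm maps the
-- whole memorized history to a decision.

Obs : Set
Obs = ℤ × ℕ

Step : Set
Step = ℕ × ℤ × ℕ × ℕ

data Decision : Set where
  stop : Decision
  go   : ℕ → Decision

Algorithm : Set
Algorithm = Obs → List Step → Decision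

module Run (A : Algorithm) (G : PortGraph) (s : Fin (n G)) where

  record Config : Set where
    constructor config
    field
      pos  : Fin (n G)
      hist : List Step
      trav : List (DirEdge G)
  open Config public

  obs₀ : Obs
  obs₀ = label G s , deg G s

  initial : Config
  initial = config s [] []

  moveBy : Config → ℕ → Maybe Config
  moveBy c p with p <? deg G (pos c)
  ... | no _   = nothing
  ... | yes lt =
    let q = fromℕ< lt
        w = nbr G (pos c) q
    in just (config w
                    (hist c ++ [ (p , label G w , deg G w , toℕ (back G (pos c) q)) ])
                    (trav c ++ [ (pos c , q) ]))

  move : Config → Maybe Config
  move c with A obs₀ (hist c)
  ... | stop = nothing
  ... | go p = moveBy c p

  -- configuration after t moves (nothing if the agent stopped earlier
  -- or chose a non-existent port)
  exec : ℕ → Maybe Config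
  exec zero    = just initial
  exec (suc t) with exec t
  ... | nothing = nothing
  ... | just c  = move c

  Halts : Config → Set
  Halts c = A obs₀ (hist c) ≡ stop

  Explored : Config → Set
  Explored c = ∀ u p → Traversed G (trav c) u p

  DistOK : ℕ → Config → Set
  DistOK D c = ∃ λ ℓ → ℓ ≤ D × Walk G (Traversed G (trav c)) (pos c) s ℓ

  penalty : Config → ℕ
  penalty c = length (trav c) ∸ numEdges G

InI : ℕ → (G : PortGraph) → Fin (n G) → Set
InI r G s = Connected G × Eccentricity G s r

-- A solves distance-constrained exploration with D = ⌊(1+α) r⌋ on (G,s):
-- it terminates, has traversed every edge, and at every moment knows a
-- path of length ≤ D to s over traversed edges.
Solves : ℕ → Algorithm → (G : PortGraph) → Fin (n G) → Set
Solves D A G s = ∃ λ T → ∃ λ c →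
    exec T ≡ just c × Halts c × Explored c
  × (∀ t → t ≤ T → ∀ c' → exec t ≡ just c' → DistOK D c')
  where open Run A G s

SolvesAll : ℕ → ℕ → Algorithm → Set
SolvesAll r D A = ∀ G s → InI r G s → Solves D A G s

{-# OPTIONS --safe #-}

-- An adversary fixes core vertices in layers 0, …, D, all of the same degree d, with the source in layer 0,
-- and answers every move through an unexplored port of a layer-i vertex with a vertex of layer i+1.
-- Each discovery thus goes one layer up, so coming back to discover another edge takes a retraversal:
-- M discoveries need at least 2M − D moves.
-- At any moment the picture can be completed to an instance: unexplored port p of every core vertex leads to a
-- hidden vertex p, all hidden vertices are adjacent to a hub, and a tail of suitable length at the hub makes the
-- eccentricity r (any core vertex is within 3 of the hub, whence r ≥ 6). In this completion the agent must at some
-- point leave through an unexplored port, and not from layer D, as the hidden vertex behind it would be at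
-- known distance D + 1 from the source. So the game goes on as long as unsaturated vertices abound, i.e. 2M < d²;
-- with d = 2m and layers of 4m vertices it reaches M = m² + D, and the final completion has penalty at least m².

module Submission where

open import Defs
open import Data.Nat using (ℕ; zero; suc; _+_; _*_; _∸_; _≤_; _<_; _<?_; _/_; z≤n; s≤s)
open import Data.Nat.Properties hiding (_≟_)
open import Data.Nat.DivMod using (/-monoˡ-≤; m*n/n≡m)
open import Data.Nat.ListAction using (sum)
open import Data.Nat.Tactic.RingSolver using (solve-∀)
open import Data.Integer as ℤ using (ℤ)
open import Data.Integer.Properties using (+-injective)
open import Data.Fin using (Fin; zero; suc; toℕ; fromℕ; fromℕ<; inject₁; splitAt; join; _↑ˡ_; combine; remQuot)
open import Data.Fin.Properties using (injective⇒≤; toℕ-injective; toℕ-fromℕ<; fromℕ<-toℕ; toℕ<n; toℕ-fromℕ;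
  toℕ-inject₁; toℕ-↑ˡ; toℕ≤pred[n]; splitAt-join; join-splitAt; remQuot-combine; combine-injectiveʳ; any?; _≟_)
open import Data.Product using (Σ; ∃; _×_; _,_; proj₁; proj₂; swap)
open import Data.Sum using (_⊎_; inj₁; inj₂; [_,_]′; map₂)
open import Data.Sum.Properties using (inj₁-injective; inj₂-injective)
open import Data.Unit using (tt)
open import Data.List using (List; []; _∷_; _++_; [_]; length; map; allFin; lookup; concat; tabulate; filter; cartesianProduct)
open import Data.List.Properties using (length-map; length-++; length-tabulate; ++-assoc; ++-identityʳ)
open import Data.List.Relation.Unary.Any as Any using (Any; here; there; index)
open import Data.List.Relation.Unary.Any.Properties using (lookup-index; ++⁺ˡ; ++⁺ʳ; ++⁻; map⁺)
open import Data.List.Relation.Unary.All as All using (All; []; _∷_)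
import Data.List.Relation.Unary.All.Properties as All
import Data.List.Relation.Unary.AllPairs as AllPairs
import Data.List.Relation.Unary.AllPairs.Properties as AllPairs
open import Data.List.Relation.Unary.Unique.Propositional using (Unique; []; _∷_)
import Data.List.Relation.Unary.Unique.Propositional.Properties as Unique
open import Data.List.Membership.Propositional using (_∈_; find; lose)
open import Data.List.Membership.Propositional.Properties
  using (∈-lookup; ∈-map⁺; ∈-map⁻; ∈-++⁺ˡ; ∈-++⁺ʳ; ∈-allFin; ∈-filter⁺; ∈-filter⁻; ∈-tabulate⁺; ∈-cartesianProduct⁻)
open import Data.Maybe using (Maybe; just; nothing)
open import Data.Maybe.Properties using (just-injective; ≡-dec)
open import Function using (_∘_; id)
open import Function.Definitions using (Injective)
open import Relation.Binary.PropositionalEquality hiding ([_])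
open import Relation.Nullary using (¬_; Dec; yes; no; contradiction; ¬?)
open import Relation.Nullary.Decidable using (map′; _×-dec_)

-- Counting by matchings between lists, and lists of undirected edges.

private variable
  X Y : Set

lookup-injective : {xs : List X} → Unique xs → Injective _≡_ _≡_ (lookup xs)
lookup-injective {xs = _ ∷ _} (x∉ ∷ u) {zero}  {zero}  eq = refl
lookup-injective {xs = _ ∷ _} (x∉ ∷ u) {zero}  {suc j} eq = contradiction eq (All.lookup x∉ (∈-lookup j))
lookup-injective {xs = _ ∷ _} (x∉ ∷ u) {suc i} {zero}  eq = contradiction (sym eq) (All.lookup x∉ (∈-lookup i))
lookup-injective {xs = _ ∷ _} (x∉ ∷ u) {suc i} {suc j} eq = cong suc (lookup-injective u eq)

-- Sending each position of `xs` to the position of its match is an injection of `Fin` types. The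
-- later counting arguments for edges and vertices are instances with different relations `R`.
matching-length-≤ : {xs : List X} {ys : List Y} (R : X → Y → Set) → Unique xs →
  (∀ {x} → x ∈ xs → Any (R x) ys) → (∀ {x x′ y} → R x y → R x′ y → x ≡ x′) →
  length xs ≤ length ys
matching-length-≤ {xs = xs} {ys} R u match R-inj = injective⇒≤ f-injective
  where
  f : Fin (length xs) → Fin (length ys)
  f i = index (match (∈-lookup i))

  f-injective : Injective _≡_ _≡_ f
  f-injective {i} {j} eq = lookup-injective u (R-inj
    (lookup-index (match (∈-lookup i)))
    (subst (R (lookup xs j) ∘ lookup ys) (sym eq) (lookup-index (match (∈-lookup j)))))

length-cartesianProduct : ∀ {X Y : Set} (xs : List X) (ys : List Y) →
  length (cartesianProduct xs ys) ≡ length xs * length ys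
length-cartesianProduct [] ys = refl
length-cartesianProduct (x ∷ xs) ys = trans (length-++ (map (x ,_) ys))
  (cong₂ _+_ (length-map (x ,_) ys) (length-cartesianProduct xs ys))

-- The disjunction is that of `Traversed`, on pairs of endpoints instead of directed edges, so that
-- a traversal converts to it directly and edges of the core can be covered in the same way.
Covered : List (X × X) → X → X → Set
Covered es u w = Any (λ (a , b) → (a ≡ u × b ≡ w) ⊎ (a ≡ w × b ≡ u)) es

bothWays : List (X × X) → List (X × X)
bothWays es = es ++ map swap es

length-bothWays : (es : List (X × X)) → length (bothWays es) ≡ 2 * length es
length-bothWays es = begin
  length (es ++ map swap es)        ≡⟨ length-++ es ⟩
  length es + length (map swap es)  ≡⟨ cong (length es +_) (length-map swap es) ⟩
  length es + length es             ≡⟨ cong (length es +_) (+-identityʳ _) ⟨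
  2 * length es                     ∎
  where open ≡-Reasoning

covered⇒∈-bothWays : {es : List (X × X)} {u w : X} → Covered es u w → Any ((u , w) ≡_) (bothWays es)
covered⇒∈-bothWays (here (inj₁ (refl , refl))) = here refl
covered⇒∈-bothWays {es = e ∷ es} (here (inj₂ (refl , refl))) = ++⁺ʳ (e ∷ es) (here refl)
covered⇒∈-bothWays {es = e ∷ es} (there c) with ++⁻ es (covered⇒∈-bothWays c)
... | inj₁ x = there (++⁺ˡ x)
... | inj₂ y = there (++⁺ʳ es (there y))

Close : ℕ → ℕ → Set
Close a b = b ≤ suc a × a ≤ suc b

-- Potentials along walks, and an upper bound for the number of edges.

module _ (G : PortGraph) where

  Lipschitz : (Fin (n G) → ℕ) → (v : Fin (n G)) → Fin (deg G v) → Set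
  Lipschitz φ v p = Close (φ v) (φ (nbr G v p))

  -- A potential that changes by at most one along every permitted edge bounds walk lengths from
  -- below. This version serves the eccentricity; the one for the start of a walk serves the
  -- distance constraint.
  walk-bound-end : ∀ {ok u v ℓ} (φ : Fin (n G) → ℕ) → (∀ {x p} → ok x p → Lipschitz φ x p) →
    Walk G ok u v ℓ → φ v ≤ ℓ + φ u
  walk-bound-end φ lip [] = ≤-refl
  walk-bound-end {u = u} {v} φ lip (_∷_ {ℓ = ℓ} p k w) = begin
    φ v                  ≤⟨ walk-bound-end φ lip w ⟩
    ℓ + φ (nbr G u p)    ≤⟨ +-monoʳ-≤ ℓ (proj₁ (lip k)) ⟩
    ℓ + suc (φ u)        ≡⟨ +-suc ℓ (φ u) ⟩
    suc ℓ + φ u          ∎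
    where open ≤-Reasoning

  walk-bound-start : ∀ {ok u v ℓ} (φ : Fin (n G) → ℕ) → (∀ {x p} → ok x p → Lipschitz φ x p) →
    Walk G ok u v ℓ → φ u ≤ ℓ + φ v
  walk-bound-start φ lip [] = ≤-refl
  walk-bound-start φ lip (_∷_ p k w) = ≤-trans (proj₂ (lip k)) (s≤s (walk-bound-start φ lip w))

  endpoints : DirEdge G → Fin (n G) × Fin (n G)
  endpoints (v , p) = v , nbr G v p

  traversed⇒covered : ∀ {tr u p} → Traversed G tr u p → Covered (map endpoints tr) u (nbr G u p)
  traversed⇒covered t = map⁺ t

  dirEdgesAt : Fin (n G) → List (DirEdge G)
  dirEdgesAt v = map (v ,_) (allFin (deg G v))

  dirEdges : List (DirEdge G)
  dirEdges = concat (map dirEdgesAt (allFin (n G)))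

  dirEdges-unique : Unique dirEdges
  dirEdges-unique = Unique.concat⁺
    (All.map⁺ (All.universal (λ v → Unique.map⁺ ,-injectiveʳ′ (Unique.allFin⁺ _)) _))
    (AllPairs.map⁺ (AllPairs.map disjoint (Unique.allFin⁺ (n G))))
    where
    ,-injectiveʳ′ : ∀ {v} {p q : Fin (deg G v)} → (v , p) ≡ (v , q) → p ≡ q
    ,-injectiveʳ′ refl = refl
    disjoint : ∀ {u v} → u ≢ v → ∀ {e} → ¬ (e ∈ dirEdgesAt u × e ∈ dirEdgesAt v)
    disjoint u≢v (e∈u , e∈v) with ∈-map⁻ _ e∈u | ∈-map⁻ _ e∈v
    ... | _ , _ , refl | _ , _ , refl = u≢v refl

  length-dirEdges : length dirEdges ≡ sum (map (deg G) (allFin (n G)))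
  length-dirEdges = count (allFin (n G))
    where
    count : ∀ vs → length (concat (map dirEdgesAt vs)) ≡ sum (map (deg G) vs)
    count [] = refl
    count (v ∷ vs) = trans (length-++ (dirEdgesAt v))
      (cong₂ _+_ (trans (length-map _ (allFin (deg G v))) (length-tabulate {n = deg G v} id)) (count vs))

  -- In a simple graph the endpoints determine a directed edge, so the directed edges match
  -- injectively into `bothWays es`, and the degree sum is at most twice the length of `es`.
  -- Repetitions in `es` do no harm.
  numEdges-cover : (es : List (Fin (n G) × Fin (n G))) →
    (∀ u p → Covered es u (nbr G u p)) → numEdges G ≤ length es
  numEdges-cover es cov = begin
    sum (map (deg G) (allFin (n G))) / 2  ≤⟨ /-monoˡ-≤ 2 degree-sum ⟩
    2 * length es / 2                     ≡⟨ cong (_/ 2) (*-comm 2 (length es)) ⟩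
    length es * 2 / 2                     ≡⟨ m*n/n≡m (length es) 2 ⟩
    length es                             ∎
    where
    open ≤-Reasoning
    match-injective : ∀ {e e′ : DirEdge G} {ab} → endpoints e ≡ ab → endpoints e′ ≡ ab → e ≡ e′
    match-injective {u , p} {u′ , p′} eq eq′ with trans eq (sym eq′)
    ... | ends≡ with cong proj₁ ends≡
    ... | refl = cong (u ,_) (no-multi G u (cong proj₂ ends≡))
    degree-sum : sum (map (deg G) (allFin (n G))) ≤ 2 * length es
    degree-sum = begin
      sum (map (deg G) (allFin (n G)))  ≡⟨ length-dirEdges ⟨
      length dirEdges                   ≤⟨ matching-length-≤ (λ e ab → endpoints e ≡ ab) dirEdges-unique
                                             (λ {(u , p)} _ → covered⇒∈-bothWays (cov u p)) match-injective ⟩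
      length (bothWays es)              ≡⟨ length-bothWays es ⟩
      2 * length es                     ∎

-- Runs of an agent on a fixed graph.

module Execution (A : Algorithm) (G : PortGraph) (s : Fin (n G)) where
  open Run A G s

  advance : (c : Config) → Fin (deg G (pos c)) → Config
  advance c p = config w (hist c ++ [ (toℕ p , label G w , deg G w , toℕ (back G (pos c) p)) ])
                       (trav c ++ [ (pos c , p) ])
    where w = nbr G (pos c) p

  move-go : ∀ c (p : Fin (deg G (pos c))) → A obs₀ (hist c) ≡ go (toℕ p) → move c ≡ just (advance c p)
  move-go c p eq with A obs₀ (hist c)
  move-go c p refl | go _ with toℕ p <? deg G (pos c)
  ... | no ≮ = contradiction (toℕ<n p) ≮
  ... | yes lt rewrite fromℕ<-toℕ p lt = refl

  move-stop : ∀ c → Halts c → move c ≡ nothing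
  move-stop c eq with A obs₀ (hist c)
  move-stop c refl | stop = refl

  move-invalid : ∀ c p → A obs₀ (hist c) ≡ go p → ¬ p < deg G (pos c) → move c ≡ nothing
  move-invalid c p eq p≮ with A obs₀ (hist c)
  move-invalid c p refl p≮ | go _ with p <? deg G (pos c)
  ... | yes lt = contradiction lt p≮
  ... | no _ = refl

  move-inv : ∀ c {c′} → move c ≡ just c′ → ∃ λ e → trav c′ ≡ trav c ++ [ e ]
  move-inv c eq with A obs₀ (hist c)
  ... | go p with p <? deg G (pos c)
  move-inv c refl | go p | yes lt = _ , refl

  exec-suc : ∀ τ {c} → exec τ ≡ just c → exec (suc τ) ≡ move c
  exec-suc τ eq rewrite eq = refl

  exec-nothing : ∀ τ {σ} → τ ≤ σ → exec τ ≡ nothing → exec σ ≡ nothing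
  exec-nothing τ {σ} τ≤σ eq = subst (λ x → exec x ≡ nothing) (m∸n+n≡m τ≤σ) (stuck (σ ∸ τ))
    where
    stuck : ∀ k → exec (k + τ) ≡ nothing
    stuck zero = eq
    stuck (suc k) rewrite stuck k = refl

  -- A failed move leaves `exec` at `nothing` forever. This makes the halting time unique.
  exec-last : ∀ {τ σ c c′} → exec τ ≡ just c → move c ≡ nothing → exec σ ≡ just c′ → σ ≤ τ
  exec-last {τ} {σ} ex dead ex′ = ≮⇒≥ λ τ<σ → contradiction
    (trans (sym (exec-nothing (suc τ) τ<σ (trans (exec-suc τ ex) dead))) ex′) λ ()

  exec-extends : ∀ j {τ c₀ c} → exec τ ≡ just c₀ → exec (j + τ) ≡ just c →
    ∃ λ es → trav c ≡ trav c₀ ++ es × length es ≡ j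
  exec-extends zero ex ex′ with trans (sym ex) ex′
  ... | refl = [] , sym (++-identityʳ _) , refl
  exec-extends (suc j) {τ} {c₀} ex ex′ with exec (j + τ) in eq
  ... | just c₁ with exec-extends j ex eq | move-inv c₁ ex′
  ... | es , tr≡ , len | e , tr≡′ = es ++ [ e ] ,
    trans tr≡′ (trans (cong (_++ [ e ]) tr≡) (++-assoc (trav c₀) es [ e ])) ,
    trans (length-++ es) (trans (+-comm _ 1) (cong suc len))

-- The adversary's partial information and the plays inside it.

module Adversary (c d : ℕ) (layer : Fin c → ℕ) (s : Fin c) (A : Algorithm) where

  -- The value `nothing` marks a port whose other end is still undecided. By `covered`, the length
  -- of `edges` bounds the number of discovered edges from above, as required both for counting
  -- saturated vertices and for bounding the edges of a completion.
  record Exploration : Set where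
    field
      target           : Fin c → Fin d → Maybe (Fin c)
      edges            : List (Fin c × Fin c)
      target-injective : ∀ {v p q w} → target v p ≡ just w → target v q ≡ just w → p ≡ q
      target-symmetric : ∀ {v p w} → target v p ≡ just w → ∃ λ q → target w q ≡ just v
      consecutive      : ∀ {v p w} → target v p ≡ just w → layer w ≡ suc (layer v) ⊎ layer v ≡ suc (layer w)
      covered          : ∀ {v p w} → target v p ≡ just w → Covered edges v w

  open Exploration

  Free : Exploration → Fin c → Set
  Free E v = ∃ λ p → target E v p ≡ nothing

  infix 4 _≟ᵗ_
  _≟ᵗ_ : (x y : Maybe (Fin c)) → Dec (x ≡ y)
  _≟ᵗ_ = ≡-dec _≟_

  free? : ∀ E v → Dec (Free E v)
  free? E v = any? λ p → target E v p ≟ᵗ nothing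

  full-target : ∀ E {v} → ¬ Free E v → ∀ p → ∃ λ w → target E v p ≡ just w
  full-target E {v} full p with target E v p in eq
  ... | just w  = w , refl
  ... | nothing = contradiction (p , eq) full

  obs : Obs
  obs = ℤ.+ toℕ s , d

  -- A run confined to explored ports, described without a graph: labels, degrees and both port
  -- numbers are already fixed by `E`, so the same play occurs in every completion of `E`.
  data Play (E : Exploration) : ℕ → Fin c → List Step → Set where
    start : Play E 0 s []
    move  : ∀ {τ v h p w q} → Play E τ v h → A obs h ≡ go (toℕ p) →
            target E v p ≡ just w → target E w q ≡ just v →
            Play E (suc τ) w (h ++ [ (toℕ p , ℤ.+ toℕ w , d , toℕ q) ])

  -- Answers are only ever added, so everything the agent has seen stays valid when the exploration
  -- grows.
  play-mono : ∀ {E E′ τ v h} → (∀ {a b x} → target E a b ≡ just x → target E′ a b ≡ just x) →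
    Play E τ v h → Play E′ τ v h
  play-mono ext start = start
  play-mono ext (move π eq fwd bwd) = move (play-mono ext π) eq (ext fwd) (ext bwd)

  -- Completing an exploration to a port graph.

  module Completion (E : Exploration) (e : ℕ) where

    -- Hidden vertices are indexed by ports, so distinct unexplored ports of one core vertex have
    -- distinct ends and no multiple edge arises. The hub is `tail zero`.
    Vertex : Set
    Vertex = Fin c ⊎ (Fin d ⊎ Fin (suc e))

    pattern core v = inj₁ v
    pattern hidden p = inj₂ (inj₁ p)
    pattern tail j = inj₂ (inj₂ j)

    size : ℕ
    size = c + (d + suc e)

    -- Core vertices come first, so their numbers, and with them their labels, are the same in all
    -- completions.
    enc : Vertex → Fin size
    enc = join c (d + suc e) ∘ map₂ (join d (suc e))

    dec : Fin size → Vertex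
    dec = map₂ (splitAt d) ∘ splitAt c

    dec-enc : ∀ x → dec (enc x) ≡ x
    dec-enc (inj₁ v) rewrite splitAt-join c (d + suc e) (inj₁ v) = refl
    dec-enc (inj₂ u) rewrite splitAt-join c (d + suc e) (inj₂ (join d (suc e) u)) =
      cong inj₂ (splitAt-join d (suc e) u)

    enc-dec : ∀ i → enc (dec i) ≡ i
    enc-dec i = trans (cong (join c (d + suc e)) (collapse (splitAt c i))) (join-splitAt c (d + suc e) i)
      where
      collapse : (x : Fin c ⊎ Fin (d + suc e)) → map₂ (join d (suc e)) (map₂ (splitAt d) x) ≡ x
      collapse (inj₁ v) = refl
      collapse (inj₂ u) = cong inj₂ (join-splitAt d (suc e) u)

    dec-injective : ∀ {i j} → dec i ≡ dec j → i ≡ j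
    dec-injective {i} {j} eq = trans (sym (enc-dec i)) (trans (cong enc eq) (enc-dec j))

    enc-injective : ∀ {x y} → enc x ≡ enc y → x ≡ y
    enc-injective {x} {y} eq = trans (sym (dec-enc x)) (trans (cong dec eq) (dec-enc y))

    data Adj : Vertex → Vertex → Set where
      core-core   : ∀ {v w p} → target E v p ≡ just w → Adj (core v) (core w)
      core-hidden : ∀ {v p} → target E v p ≡ nothing → Adj (core v) (hidden p)
      hidden-core : ∀ {v p} → target E v p ≡ nothing → Adj (hidden p) (core v)
      hidden-tail : ∀ {p} → Adj (hidden p) (tail zero)
      tail-hidden : ∀ {p} → Adj (tail zero) (hidden p)
      tail-up     : ∀ {i j} → toℕ j ≡ suc (toℕ i) → Adj (tail i) (tail j)
      tail-down   : ∀ {i j} → toℕ i ≡ suc (toℕ j) → Adj (tail i) (tail j)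

    Adj-sym : ∀ {x y} → Adj x y → Adj y x
    Adj-sym (core-core eq)   = core-core (proj₂ (target-symmetric E eq))
    Adj-sym (core-hidden eq) = hidden-core eq
    Adj-sym (hidden-core eq) = core-hidden eq
    Adj-sym hidden-tail      = tail-hidden
    Adj-sym tail-hidden      = hidden-tail
    Adj-sym (tail-up eq)     = tail-down eq
    Adj-sym (tail-down eq)   = tail-up eq

    Adj-irrefl : ∀ {x} → ¬ Adj x x
    Adj-irrefl (core-core eq) with consecutive E eq
    ... | inj₁ l≡ = 1+n≢n (sym l≡)
    ... | inj₂ l≡ = 1+n≢n (sym l≡)
    Adj-irrefl (tail-up eq)   = 1+n≢n (sym eq)
    Adj-irrefl (tail-down eq) = 1+n≢n (sym eq)

    adj? : ∀ u y → Dec (Adj (inj₂ u) y)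
    adj? (inj₁ p) (core v) = map′ hidden-core (λ {(hidden-core eq) → eq}) (target E v p ≟ᵗ nothing)
    adj? (inj₁ p) (hidden q) = no λ ()
    adj? (inj₁ p) (tail zero) = yes hidden-tail
    adj? (inj₁ p) (tail (suc j)) = no λ ()
    adj? (inj₂ i) (core v) = no λ ()
    adj? (inj₂ zero) (hidden q) = yes tail-hidden
    adj? (inj₂ (suc i)) (hidden q) = no λ ()
    adj? (inj₂ i) (tail j) with toℕ j Data.Nat.≟ suc (toℕ i) | toℕ i Data.Nat.≟ suc (toℕ j)
    ... | yes eq | _      = yes (tail-up eq)
    ... | no _   | yes eq = yes (tail-down eq)
    ... | no ≢₁  | no ≢₂  = no λ { (tail-up eq) → ≢₁ eq ; (tail-down eq) → ≢₂ eq }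

    -- Ports of core vertices are dictated by `target`. Hidden and tail vertices may number their
    -- ports in any order, since no answer given during a play depends on it; here the order is that
    -- of the vertex enumeration.
    neighbours : Fin d ⊎ Fin (suc e) → List Vertex
    neighbours u = filter (adj? u) (map dec (allFin size))

    degree : Vertex → ℕ
    degree (core _) = d
    degree (inj₂ u) = length (neighbours u)

    arrive : Maybe (Fin c) → Fin d → Vertex
    arrive (just w) _ = core w
    arrive nothing  p = hidden p

    neighbour : (x : Vertex) → Fin (degree x) → Vertex
    neighbour (core v) p = arrive (target E v p) p
    neighbour (inj₂ u) p = lookup (neighbours u) p

    neighbour-adj : ∀ x p → Adj x (neighbour x p)
    neighbour-adj (core v) p with target E v p in eq
    ... | just w  = core-core eq
    ... | nothing = core-hidden eq
    neighbour-adj (inj₂ u) p =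
      proj₂ (∈-filter⁻ (adj? u) {xs = map dec (allFin size)} (∈-lookup {xs = neighbours u} p))

    adj-neighbour : ∀ {x y} → Adj x y → ∃ λ p → neighbour x p ≡ y
    adj-neighbour (core-core {p = p} eq)   = p , cong (λ t → arrive t p) eq
    adj-neighbour (core-hidden {p = p} eq) = p , cong (λ t → arrive t p) eq
    adj-neighbour {inj₂ u} {y} a = index y∈ , sym (lookup-index y∈)
      where
      y∈ : y ∈ neighbours u
      y∈ = ∈-filter⁺ (adj? u) (subst (_∈ map dec (allFin size)) (dec-enc y) (∈-map⁺ dec (∈-allFin (enc y)))) a

    neighbour-injective : ∀ x {p q} → neighbour x p ≡ neighbour x q → p ≡ q
    neighbour-injective (core v) {p} {q} eq with target E v p in eqp | target E v q in eqq
    ... | just _  | just _  = target-injective E eqp (trans eqq (sym (cong just (inj₁-injective eq))))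
    ... | nothing | nothing = inj₁-injective (inj₂-injective eq)
    neighbour-injective (inj₂ u) eq = lookup-injective
      (Unique.filter⁺ (adj? u) (Unique.map⁺ dec-injective (Unique.allFin⁺ size))) eq

    neighbour-return : ∀ x p → ∃ λ q → neighbour (neighbour x p) q ≡ x
    neighbour-return x p = adj-neighbour (Adj-sym (neighbour-adj x p))

    reindex : ∀ {x y z} → x ≡ y → (∃ λ q → neighbour y q ≡ z) → ∃ λ q → neighbour x q ≡ z
    reindex refl q = q

    return-port : ∀ i p → ∃ λ q → neighbour (dec (enc (neighbour (dec i) p))) q ≡ dec i
    return-port i p = reindex (dec-enc (neighbour (dec i) p)) (neighbour-return (dec i) p)

    graph : PortGraph
    graph = record
      { n = size
      ; deg = degree ∘ dec
      ; nbr = λ i p → enc (neighbour (dec i) p)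
      ; back = λ i p → proj₁ (return-port i p)
      ; back-correct = λ i p → trans (cong enc (proj₂ (return-port i p))) (enc-dec i)
      ; loopless = λ i p eq → Adj-irrefl (subst (Adj (dec i))
          (trans (sym (dec-enc (neighbour (dec i) p))) (cong dec eq)) (neighbour-adj (dec i) p))
      ; no-multi = λ i eq → neighbour-injective (dec i)
          (enc-injective eq)
      ; label = ℤ.+_ ∘ toℕ
      ; label-inj = toℕ-injective ∘ +-injective
      }

    source : Fin size
    source = enc (core s)

    dec-nbr : ∀ i p → dec (nbr graph i p) ≡ neighbour (dec i) p
    dec-nbr i p = dec-enc (neighbour (dec i) p)

    nbr-adj : ∀ i p → Adj (dec i) (dec (nbr graph i p))
    nbr-adj i p = subst (Adj (dec i)) (sym (dec-nbr i p)) (neighbour-adj (dec i) p)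

    lipschitz : (φ : Vertex → ℕ) → (∀ {x y} → Adj x y → φ y ≤ suc (φ x)) →
      ∀ i p → Lipschitz graph (φ ∘ dec) i p
    lipschitz φ lip i p = lip (nbr-adj i p) , lip (Adj-sym (nbr-adj i p))

    data Path : Vertex → Vertex → ℕ → Set where
      []  : ∀ {x} → Path x x 0
      _∷_ : ∀ {x y z ℓ} → Adj x y → Path y z ℓ → Path x z (suc ℓ)

    infixr 5 _++ᵖ_
    _++ᵖ_ : ∀ {x y z k ℓ} → Path x y k → Path y z ℓ → Path x z (k + ℓ)
    []      ++ᵖ π = π
    (a ∷ ρ) ++ᵖ π = a ∷ (ρ ++ᵖ π)

    reverseᵖ : ∀ {x y ℓ} → Path x y ℓ → Path y x ℓ
    reverseᵖ [] = []
    reverseᵖ {ℓ = suc ℓ} (a ∷ π) = subst (Path _ _) (+-comm ℓ 1) (reverseᵖ π ++ᵖ (Adj-sym a ∷ []))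

    path⇒walk : ∀ {x y ℓ i j} → Path x y ℓ → dec i ≡ x → dec j ≡ y → Walk graph (anyEdge graph) i j ℓ
    path⇒walk [] eqi eqj with refl ← dec-injective (trans eqi (sym eqj)) = []
    path⇒walk {i = i} (a ∷ π) refl eqj with p , eq ← adj-neighbour a =
      _∷_ p tt (path⇒walk π (trans (dec-nbr i p) eq) eqj)

    tail-path : ∀ k (j : Fin (suc e)) → toℕ j ≡ k → Path (tail j) (tail zero) k
    tail-path zero    zero    eq = []
    tail-path (suc k) (suc j) eq =
      tail-down (cong suc (sym (toℕ-inject₁ j))) ∷
      tail-path k (inject₁ j) (trans (toℕ-inject₁ j) (suc-injective eq))

    free-path : ∀ {v} → Free E v → Path (core v) (tail zero) 2
    free-path (p , eq) = core-hidden eq ∷ hidden-tail ∷ []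

    -- The eccentricity of the source is set by the tail: b says whether the
    -- hub tail 0 is at distance 2 or 3 from the source.
    module _ (nearFree : ∀ v → ¬ Free E v → ∃ λ p → ∃ λ w → target E v p ≡ just w × Free E w)
             (b : ℕ) (b-spec : (Free E s × b ≡ 0) ⊎ (¬ Free E s × b ≡ 1))
             (6≤ecc : 6 ≤ 2 + b + e) where

      ecc : ℕ
      ecc = 2 + b + e

      full-path : ∀ {v} → ¬ Free E v → Path (core v) (tail zero) 3
      full-path full with p , w , eq , free ← nearFree _ full = core-core eq ∷ free-path free

      source-path : Path (core s) (tail zero) (2 + b)
      source-path = [ (λ (free , b≡0) → subst (λ k → Path _ _ (2 + k)) (sym b≡0) (free-path free))
                    , (λ (full , b≡1) → subst (λ k → Path _ _ (2 + k)) (sym b≡1) (full-path full)) ]′ b-spec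

      b≤1 : b ≤ 1
      b≤1 = [ (λ (_ , b≡0) → ≤-trans (≤-reflexive b≡0) z≤n) , (λ (_ , b≡1) → ≤-reflexive b≡1) ]′ b-spec

      -- The hub is at most 3 away from the source, and every core vertex at most 3 away from the
      -- hub. This is what the bound 6 on the eccentricity pays for.
      hub+3≤ecc : 2 + b + 3 ≤ ecc
      hub+3≤ecc = ≤-trans (+-monoˡ-≤ 3 (+-monoʳ-≤ 2 b≤1)) 6≤ecc

      hub-path : ∀ x → ∃ λ ℓ → Path x (tail zero) ℓ × 2 + b + ℓ ≤ ecc
      hub-path (core v) with free? E v
      ... | yes free = 2 , free-path free , ≤-trans (+-monoʳ-≤ (2 + b) (n≤1+n 2)) hub+3≤ecc
      ... | no full  = 3 , full-path full , hub+3≤ecc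
      hub-path (hidden p) = 1 , hidden-tail ∷ [] , ≤-trans (+-monoʳ-≤ (2 + b) (s≤s z≤n)) hub+3≤ecc
      hub-path (tail j) = toℕ j , tail-path _ j refl , +-monoʳ-≤ (2 + b) (toℕ≤pred[n] j)

      connected : Connected graph
      connected i j =
        let _ , π , _ = hub-path (dec i)
            _ , ρ , _ = hub-path (dec j)
        in _ , path⇒walk (π ++ᵖ reverseᵖ ρ) refl refl

      -- A lower bound for the distance to the source. It is 1-Lipschitz because for `b` equal to 1
      -- the source is saturated, so hidden vertices touch only core vertices of depth 1, while for
      -- `b` equal to 0 all core vertices have depth 0.
      depth : Vertex → ℕ
      depth (core v) with v ≟ s
      ... | yes _ = 0
      ... | no _  = b
      depth (hidden _) = suc b
      depth (tail j)   = 2 + b + toℕ j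

      depth-core≤ : ∀ v → depth (core v) ≤ b
      depth-core≤ v with v ≟ s
      ... | yes _ = z≤n
      ... | no _  = ≤-refl

      depth-free≥ : ∀ {v} → Free E v → b ≤ depth (core v)
      depth-free≥ {v} free with v ≟ s
      ... | no _ = ≤-refl
      ... | yes v≡s = [ (λ (_ , b≡0) → ≤-reflexive b≡0)
                      , (λ (full , _) → contradiction (subst (Free E) v≡s free) full) ]′ b-spec

      depth-lipschitz : ∀ {x y} → Adj x y → depth y ≤ suc (depth x)
      depth-lipschitz (core-core {w = w} _) = ≤-trans (depth-core≤ w) (≤-trans b≤1 (s≤s z≤n))
      depth-lipschitz (core-hidden eq) = s≤s (depth-free≥ (_ , eq))
      depth-lipschitz (hidden-core {v} _) = ≤-trans (depth-core≤ v) (≤-trans (n≤1+n b) (n≤1+n (suc b)))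
      depth-lipschitz hidden-tail = ≤-reflexive (cong (2 +_) (+-identityʳ b))
      depth-lipschitz tail-hidden = ≤-trans (s≤s (m≤m+n b 0)) (≤-trans (n≤1+n _) (n≤1+n _))
      depth-lipschitz (tail-up {i} eq) = ≤-reflexive (trans (cong (2 + b +_) eq) (+-suc (2 + b) (toℕ i)))
      depth-lipschitz (tail-down {i} {j} eq) =
        ≤-trans (+-monoʳ-≤ (2 + b) (≤-trans (n≤1+n (toℕ j)) (≤-reflexive (sym eq)))) (n≤1+n _)

      depth-source : depth (core s) ≡ 0
      depth-source with s ≟ s
      ... | yes _  = refl
      ... | no s≢s = contradiction refl s≢s

      instance-of : InI ecc graph source
      instance-of = connected ,
        (λ i → let ℓ , π , ℓ≤ = hub-path (dec i) in
          2 + b + ℓ , ℓ≤ , path⇒walk (source-path ++ᵖ reverseᵖ π) (dec-enc (core s)) refl) ,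
        -- The end of the tail has `depth` exactly `ecc` and so witnesses the lower bound; the upper
        -- bound goes through the hub.
        enc (tail (fromℕ e)) , λ ℓ w → far ℓ (walk-bound-end graph (depth ∘ dec)
          (λ {i} {p} _ → lipschitz depth depth-lipschitz i p) w)
        where
        far : ∀ ℓ → depth (dec (enc (tail (fromℕ e)))) ≤ ℓ + depth (dec source) → ecc ≤ ℓ
        far ℓ le rewrite dec-enc (tail (fromℕ e)) | dec-enc (core s) | toℕ-fromℕ e | depth-source | +-identityʳ ℓ = le

    -- The port set of a vertex that decodes to `core v` is `Fin d` only up to that equation, so
    -- ports are carried across by their numbers.
    core-port : ∀ {x v} → x ≡ core v → (p : Fin d) →
      ∃ λ (p′ : Fin (degree x)) → toℕ p′ ≡ toℕ p × neighbour x p′ ≡ arrive (target E v p) p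
    core-port refl p = p , refl , refl

    core-toℕ : ∀ {i v} → dec i ≡ core v → toℕ i ≡ toℕ v
    core-toℕ {i} {v} eq = trans (cong toℕ (trans (sym (enc-dec i)) (cong enc eq))) (toℕ-↑ˡ v _)

    core-degree : ∀ {i v} → dec i ≡ core v → deg graph i ≡ d
    core-degree = cong degree

    -- The return port is forced: it and `q` both lead back to `v`, and there are no multiple edges.
    core-back : ∀ {i v w q} p → dec i ≡ core v → dec (nbr graph i p) ≡ core w → target E w q ≡ just v →
      toℕ (back graph i p) ≡ toℕ q
    core-back {i} {v} {w} {q} p eqi eqw eq with core-port eqw q
    ... | q′ , q′≡q , step = trans (cong toℕ (no-multi graph (nbr graph i p) {x = back graph i p} {y = q′}
      (trans (back-correct graph i p) (sym (trans (cong enc (trans step (cong (λ t → arrive t q) eq)))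
        (trans (cong enc (sym eqi)) (enc-dec i))))))) q′≡q

  -- Few saturated vertices while few edges are discovered.

  module Counting (E : Exploration) (sparse : 2 * length (edges E) < d * d) where

    -- Each saturated vertex contributes `d` explored ports, and all of these match injectively into
    -- `bothWays (edges E)`, which has fewer than `d * d` entries.
    few-full : ∀ {ws} → Unique ws → All (¬_ ∘ Free E) ws → length ws < d
    few-full {ws} ws! full = *-cancelʳ-< d (length ws) d (begin-strict
      length ws * d                          ≡⟨ cong (length ws *_) (length-tabulate {n = d} id) ⟨
      length ws * length (allFin d)          ≡⟨ length-cartesianProduct ws (allFin d) ⟨
      length (cartesianProduct ws (allFin d)) ≤⟨ matching-length-≤ Exits
                                                  (Unique.cartesianProduct⁺ ws! (Unique.allFin⁺ d)) exits exits-injective ⟩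
      length (bothWays (edges E))            ≡⟨ length-bothWays (edges E) ⟩
      2 * length (edges E)                   <⟨ sparse ⟩
      d * d                                  ∎)
      where
      open ≤-Reasoning
      Exits : Fin c × Fin d → Fin c × Fin c → Set
      Exits (v , p) (a , b) = v ≡ a × target E v p ≡ just b
      exits : ∀ {x} → x ∈ cartesianProduct ws (allFin d) → Any (Exits x) (bothWays (edges E))
      exits {v , p} x∈ with v∈ws , _ ← ∈-cartesianProduct⁻ ws (allFin d) x∈
                       with w , eq ← full-target E (All.lookup full v∈ws) p =
        Any.map (λ {refl → refl , eq}) (covered⇒∈-bothWays (covered E eq))
      exits-injective : ∀ {x x′ y} → Exits x y → Exits x′ y → x ≡ x′
      exits-injective {v , _} (refl , eq) (refl , eq′) = cong (v ,_) (target-injective E eq eq′)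

    -- The `d` neighbours of a saturated vertex are distinct, too many to be all saturated. This
    -- puts every core vertex within distance 3 of the hub.
    nearFree : ∀ v → ¬ Free E v → ∃ λ p → ∃ λ w → target E v p ≡ just w × Free E w
    nearFree v full with any? (λ p → free? E (proj₁ (full-target E full p)))
    ... | yes (p , free) = p , _ , proj₂ (full-target E full p) , free
    ... | no allFull = contradiction
      (few-full (Unique.tabulate⁺ {f = reached} reached-injective) (All.tabulate⁺ λ p free → allFull (p , free)))
      (≤⇒≯ (≤-reflexive (sym (length-tabulate reached))))
      where
      reached : Fin d → Fin c
      reached p = proj₁ (full-target E full p)
      reached-injective : ∀ {p q} → reached p ≡ reached q → p ≡ q
      reached-injective {p} {q} eq = target-injective E (proj₂ (full-target E full p))
        (trans (proj₂ (full-target E full q)) (sym (cong just eq)))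

    fresh? : ∀ v w → Dec (Free E w × ¬ ∃ λ p → target E v p ≡ just w)
    fresh? v w = free? E w ×-dec ¬? (any? λ p → target E v p ≟ᵗ just w)

    -- Fewer than `d` candidates are saturated and at most `d` are already adjacent to `v`, so
    -- `d + d` candidates leave one to spare.
    fresh-neighbour : ∀ v {ws} → Unique ws → d + d ≤ length ws →
      ∃ λ w → w ∈ ws × Free E w × (∀ p → target E v p ≢ just w)
    fresh-neighbour v {ws} ws! long with Any.any? (fresh? v) ws
    ... | yes found = let w , w∈ , free , far = find found in w , w∈ , free , λ p eq → far (p , eq)
    ... | no none = contradiction long (<⇒≱ (begin-strict
      length ws                                      ≤⟨ matching-length-≤ (λ w y → just w ≡ y) ws! spoilt
                                                          (λ {eq refl → just-injective eq}) ⟩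
      length (map just fulls ++ tabulate (target E v)) ≡⟨ length-++ (map just fulls) ⟩
      length (map just fulls) + length (tabulate (target E v))
        ≡⟨ cong₂ _+_ (length-map just fulls) (length-tabulate (target E v)) ⟩
      length fulls + d                               <⟨ +-monoˡ-< d (few-full (Unique.filter⁺ full? ws!)
                                                          (All.all-filter full? ws)) ⟩
      d + d                                          ∎))
      where
      open ≤-Reasoning
      full? : ∀ w → Dec (¬ Free E w)
      full? w = ¬? (free? E w)
      fulls : List (Fin c)
      fulls = filter full? ws
      spoilt : ∀ {w} → w ∈ ws → Any (just w ≡_) (map just fulls ++ tabulate (target E v))
      spoilt {w} w∈ with free? E w
      ... | no full = ∈-++⁺ˡ (∈-map⁺ just (∈-filter⁺ full? w∈ full))
      ... | yes free with any? (λ p → target E v p ≟ᵗ just w)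
      ... | yes (p , eq) = ∈-++⁺ʳ (map just fulls) (subst (_∈ tabulate (target E v)) eq (∈-tabulate⁺ p))
      ... | no far = contradiction (lose w∈ (free , far)) none

  -- Adding one discovered edge to an exploration.

  set : (Fin c → Fin d → Maybe (Fin c)) → Fin c → Fin d → Fin c → Fin c → Fin d → Maybe (Fin c)
  set t v p x a b with a ≟ v ×-dec b ≟ p
  ... | yes _ = just x
  ... | no _  = t a b

  module _ (t : Fin c → Fin d → Maybe (Fin c)) (v : Fin c) (p : Fin d) (x : Fin c) where

    set-same : set t v p x v p ≡ just x
    set-same with v ≟ v ×-dec p ≟ p
    ... | yes _ = refl
    ... | no ≢  = contradiction (refl , refl) ≢

    set-other : ∀ {a b} → ¬ (a ≡ v × b ≡ p) → set t v p x a b ≡ t a b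
    set-other {a} {b} ≢ with a ≟ v ×-dec b ≟ p
    ... | yes eq = contradiction eq ≢
    ... | no _   = refl

    set-keeps : t v p ≡ nothing → ∀ {a b y} → t a b ≡ just y → set t v p x a b ≡ just y
    set-keeps eq eq′ = trans (set-other λ {(refl , refl) → contradiction (trans (sym eq) eq′) λ ()}) eq′

    set-inv : ∀ {a b y} → set t v p x a b ≡ just y → (a ≡ v × b ≡ p × y ≡ x) ⊎ t a b ≡ just y
    set-inv {a} {b} eq with a ≟ v ×-dec b ≟ p
    ... | yes (a≡v , b≡p) = inj₁ (a≡v , b≡p , sym (just-injective eq))
    ... | no _ = inj₂ eq

  module Growth (E : Exploration) {v p w q} (vp-free : target E v p ≡ nothing) (wq-free : target E w q ≡ nothing)
                (up : layer w ≡ suc (layer v)) (far : ∀ p → target E v p ≢ just w) where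

    v≢w : v ≢ w
    v≢w refl = 1+n≢n (sym up)

    withReturn target′ : Fin c → Fin d → Maybe (Fin c)
    withReturn = set (target E) w q v
    target′ = set withReturn v p w

    forward : target′ v p ≡ just w
    forward = set-same withReturn v p w

    backward : target′ w q ≡ just v
    backward = trans (set-other withReturn v p w (v≢w ∘ sym ∘ proj₁)) (set-same (target E) w q v)

    keeps : ∀ {a b x} → target E a b ≡ just x → target′ a b ≡ just x
    keeps {a} {b} eq = set-keeps withReturn v p w
      (trans (set-other (target E) w q v (v≢w ∘ proj₁)) vp-free) {a} {b} (set-keeps (target E) w q v wq-free eq)

    -- A case view of the updated table, against which each field of the enlarged exploration is
    -- checked.
    data Origin : Fin c → Fin d → Fin c → Set where
      fwd : Origin v p w
      bwd : Origin w q v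
      old : ∀ {a b x} → target E a b ≡ just x → Origin a b x

    origin : ∀ a b {x} → target′ a b ≡ just x → Origin a b x
    origin a b eq with set-inv withReturn v p w {a} {b} eq
    ... | inj₁ (refl , refl , refl) = fwd
    ... | inj₂ eq′ with set-inv (target E) w q v {a} {b} eq′
    ... | inj₁ (refl , refl , refl) = bwd
    ... | inj₂ eq″ = old eq″

    far′ : ∀ q → target E w q ≢ just v
    far′ q eq = far _ (proj₂ (target-symmetric E eq))

    origin-injective : ∀ {a b b′ x} → Origin a b x → Origin a b′ x → b ≡ b′
    origin-injective fwd fwd = refl
    origin-injective fwd bwd = contradiction refl v≢w
    origin-injective fwd (old eq) = contradiction eq (far _)
    origin-injective bwd fwd = contradiction refl v≢w
    origin-injective bwd bwd = refl
    origin-injective bwd (old eq) = contradiction eq (far′ _)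
    origin-injective (old eq) fwd = contradiction eq (far _)
    origin-injective (old eq) bwd = contradiction eq (far′ _)
    origin-injective (old eq) (old eq′) = target-injective E eq eq′

    origin-symmetric : ∀ {a b x} → Origin a b x → ∃ λ b′ → target′ x b′ ≡ just a
    origin-symmetric fwd = q , backward
    origin-symmetric bwd = p , forward
    origin-symmetric (old eq) = let b′ , eq′ = target-symmetric E eq in b′ , keeps eq′

    origin-consecutive : ∀ {a b x} → Origin a b x → layer x ≡ suc (layer a) ⊎ layer a ≡ suc (layer x)
    origin-consecutive fwd = inj₁ up
    origin-consecutive bwd = inj₂ up
    origin-consecutive (old eq) = consecutive E eq

    origin-covered : ∀ {a b x} → Origin a b x → Covered ((v , w) ∷ edges E) a x
    origin-covered fwd = here (inj₁ (refl , refl))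
    origin-covered bwd = here (inj₂ (refl , refl))
    origin-covered (old eq) = there (covered E eq)

    grown : Exploration
    grown = record
      { target = target′
      ; edges = (v , w) ∷ edges E
      ; target-injective = λ {a} {b} {b′} eq eq′ → origin-injective (origin a b eq) (origin a b′ eq′)
      ; target-symmetric = λ {a} {b} eq → origin-symmetric (origin a b eq)
      ; consecutive = λ {a} {b} eq → origin-consecutive (origin a b eq)
      ; covered = λ {a} {b} eq → origin-covered (origin a b eq)
      }

  -- Plays as actual runs in a completion.

  module Simulation (E : Exploration) (e : ℕ) where
    open Completion E e
    open Run A graph source renaming (move to moveᵣ)
    open Execution A graph source

    obs₀≡obs : obs₀ ≡ obs
    obs₀≡obs = cong₂ _,_ (cong ℤ.+_ (core-toℕ (dec-enc (core s)))) (core-degree (dec-enc (core s)))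

    Known : DirEdge graph → Set
    Known (i , p) = ∃ λ v → ∃ λ q → ∃ λ w →
      dec i ≡ core v × dec (nbr graph i p) ≡ core w × target E v q ≡ just w

    -- The run in the completion has the same memory as the play, so the agent decides alike in
    -- both. All traversed edges lie in the explored core.
    record Tracks (τ : ℕ) (v : Fin c) (h : List Step) : Set where
      field
        conf     : Config
        runs     : exec τ ≡ just conf
        at       : dec (pos conf) ≡ core v
        recalls  : hist conf ≡ h
        duration : length (trav conf) ≡ τ
        known    : All Known (trav conf)

      decides : ∀ {x} → A obs h ≡ x → A obs₀ (hist conf) ≡ x
      decides = trans (cong₂ A obs₀≡obs recalls)

      -- The port may be unexplored; the move then ends at a hidden vertex, and this is the case in
      -- which the distance constraint is later tested.
      take : ∀ {p} → A obs h ≡ go (toℕ p) → ∃ λ p′ → exec (suc τ) ≡ just (advance conf p′) ×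
        toℕ p′ ≡ toℕ p × dec (nbr graph (pos conf) p′) ≡ arrive (target E v p) p
      take {p} eq with p′ , p′≡p , step ← core-port at p =
        p′ , trans (exec-suc τ runs) (move-go conf p′ (trans (decides eq) (cong go (sym p′≡p)))) ,
        p′≡p , trans (dec-nbr (pos conf) p′) step

    tracks : ∀ {τ v h} → Play E τ v h → Tracks τ v h
    tracks start = record
      { conf = initial ; runs = refl ; at = dec-enc (core s) ; recalls = refl ; duration = refl ; known = [] }
    tracks (move {τ} {v} {p = p} {w = w} {q = q} π eq eqf eqb) with tracks π
    ... | tr with p′ , runs′ , p′≡p , step ← Tracks.take tr {p} eq = record
      { conf = advance conf p′
      ; runs = runs′
      ; at = step′
      ; recalls = cong₂ _++_ recalls (cong [_] (cong₂ _,_ p′≡p (cong₂ _,_ (cong ℤ.+_ (core-toℕ step′))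
          (cong₂ _,_ (core-degree step′) (core-back p′ at step′ eqb)))))
      ; duration = trans (length-++ (trav conf)) (trans (+-comm _ 1) (cong suc duration))
      ; known = All.++⁺ known ((v , p , w , at , step′ , eqf) ∷ [])
      }
      where
      open Tracks tr
      step′ : dec (nbr graph (pos conf) p′) ≡ core w
      step′ = trans step (cong (λ t → arrive t p) eqf)

    known-traversed : ∀ {tr i p q} → All Known tr → Traversed graph tr i p → dec (nbr graph i p) ≢ hidden q
    known-traversed (( _ , _ , _ , _ , to , _) ∷ _) (here (inj₁ (_ , nbr≡))) eq
      with () ← trans (sym to) (trans (cong dec nbr≡) eq)
    known-traversed (( _ , _ , _ , from , _) ∷ _) (here (inj₂ (v≡nbr , _))) eq
      with () ← trans (sym from) (trans (cong dec v≡nbr) eq)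
    known-traversed (_ ∷ ks) (there t) eq = known-traversed ks t eq

    halted-last : ∀ {T c σ c′} → exec T ≡ just c → Halts c → exec σ ≡ just c′ → σ ≤ T
    halted-last {c = c} ex halts = exec-last ex (move-stop c halts)

    -- The bound `τ<T` keeps the configuration just after the move through the free port inside the
    -- run, where the distance constraint still applies.
    record Frontier (T : ℕ) : Set where
      field
        {τ}   : ℕ
        {v}   : Fin c
        {h}   : List Step
        {p}   : Fin d
        play  : Play E τ v h
        long  : 2 * length (edges E) ≤ τ + layer v
        takes : A obs h ≡ go (toℕ p)
        free  : target E v p ≡ nothing
        τ<T   : τ < T

    -- A must traverse every edge, so it eventually takes an unexplored port.
    frontier : ∀ {T cT} → exec T ≡ just cT → Halts cT → Explored cT → ∃ (Free E) →
      ∀ {τ v h} → Play E τ v h → 2 * length (edges E) ≤ τ + layer v → ∀ f → τ + f ≡ suc T → Frontier T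
    frontier {T} {cT} ex halts explored (v₀ , p₀ , free₀) {τ} {v} {h} π long = search π long
      where
      stuck : ∀ {τ v h} → (tr : Tracks τ v h) → moveᵣ (Tracks.conf tr) ≡ nothing → τ ≡ T
      stuck tr dead = ≤-antisym (halted-last ex halts (Tracks.runs tr)) (exec-last (Tracks.runs tr) dead ex)

      same : ∀ {τ v h} → (tr : Tracks τ v h) → τ ≡ T → Tracks.conf tr ≡ cT
      same tr refl = just-injective (trans (sym (Tracks.runs tr)) ex)

      going : ∀ {τ v h p} → Tracks τ v h → A obs h ≡ go p → τ ≢ T
      going tr eq τ≡T with refl ← same tr τ≡T with () ← trans (sym halts) (Tracks.decides tr eq)

      -- The fuel `f` counts the moves left until time `suc T`, which no configuration of the
      -- halting run reaches.
      search : ∀ {τ v h} → Play E τ v h → 2 * length (edges E) ≤ τ + layer v → ∀ f → τ + f ≡ suc T → Frontier T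
      search {τ} {v} {h} π long zero eq = contradiction
        (≤-trans (≤-reflexive (trans (sym eq) (+-identityʳ τ))) (halted-last ex halts (Tracks.runs (tracks π)))) 1+n≰n
      search {τ} {v} {h} π long (suc f) eq with A obs h in decision
      -- Stopping here would end the run with the edge at the free port `p₀` of `v₀` untraversed:
      -- its far end is hidden, while all traversed edges have both ends in the core.
      ... | stop = contradiction (trans (dec-nbr (enc (core v₀)) p′) (trans step (cong (λ t → arrive t p₀) free₀)))
              (known-traversed (subst (All Known ∘ trav) (same tr (stuck tr (move-stop conf (decides decision)))) known)
                (explored (enc (core v₀)) p′))
        where
        tr : Tracks τ v h
        tr = tracks π
        open Tracks tr
        port : ∃ λ (p′ : Fin (degree (dec (enc (core v₀))))) →
          toℕ p′ ≡ toℕ p₀ × neighbour (dec (enc (core v₀))) p′ ≡ arrive (target E v₀ p₀) p₀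
        port = core-port (dec-enc (core v₀)) p₀
        p′ : Fin (degree (dec (enc (core v₀))))
        p′ = proj₁ port
        step : neighbour (dec (enc (core v₀))) p′ ≡ arrive (target E v₀ p₀) p₀
        step = proj₂ (proj₂ port)
      ... | go m with m <? d
      -- A nonexistent port would also end the run, hence at time `T`; but there the agent decides
      -- `stop`, not `go`.
      ... | no m≮d = contradiction (stuck tr (move-invalid conf m (decides decision)
              (m≮d ∘ subst (m <_) (core-degree at)))) (going tr decision)
        where
        tr : Tracks τ v h
        tr = tracks π
        open Tracks tr
      ... | yes m<d with target E v (fromℕ< m<d) in eqt
      ... | nothing = record
              { play = π ; long = long ; takes = decision′ ; free = eqt
              ; τ<T = ≤∧≢⇒< (halted-last ex halts (Tracks.runs (tracks π))) (going (tracks π) decision) }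
        where
        decision′ : A obs h ≡ go (toℕ (fromℕ< m<d))
        decision′ = trans decision (cong go (sym (toℕ-fromℕ< m<d)))
      ... | just w = search (move π decision′ eqt (proj₂ (target-symmetric E eqt)))
              (≤-trans long closer) f (trans (sym (+-suc τ f)) eq)
        where
        decision′ : A obs h ≡ go (toℕ (fromℕ< m<d))
        decision′ = trans decision (cong go (sym (toℕ-fromℕ< m<d)))
        -- A move inside the core descends by at most one layer, so the elapsed time makes up for
        -- the loss.
        closer : τ + layer v ≤ suc τ + layer w
        closer with consecutive E eqt
        ... | inj₁ up   = +-mono-≤ (n≤1+n τ) (≤-trans (n≤1+n _) (≤-reflexive (sym up)))
        ... | inj₂ down = ≤-reflexive (trans (cong (τ +_) down) (+-suc τ _))

    -- Consequences of the distance constraint, and the penalty of a completed run.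

    module _ (D : ℕ) (layer≤D : ∀ v → layer v ≤ D) (layer-s : layer s ≡ 0) where

      -- At layer D the frontier port leads to a hidden vertex, whose distance
      -- to s over traversed edges is D + 1.
      frontier-layer : ∀ {T} → (∀ t → t ≤ T → ∀ c′ → exec t ≡ just c′ → DistOK D c′) →
        (fr : Frontier T) → layer (Frontier.v fr) < D
      frontier-layer {T} dist fr = ≰⇒> λ D≤layer → 1+n≰n (beyond D≤layer)
        where
        open Frontier fr
        open Tracks (tracks play)

        -- A potential that has to be Lipschitz only along traversed edges: the explored ones join
        -- consecutive layers, and the edge just taken climbs from layer `D`, by `D≤layer`, to the
        -- value `suc D`.
        known-layer : Vertex → ℕ
        known-layer (core u) = layer u
        known-layer _        = suc D

        Tame : DirEdge graph → Set
        Tame (i , p) = Lipschitz graph (known-layer ∘ dec) i p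

        known-tame : ∀ {e} → Known e → Tame e
        known-tame (v , _ , w , from , to , eq) =
          subst₂ (λ x y → Close (known-layer x) (known-layer y)) (sym from) (sym to) close
          where
          close : Close (layer v) (layer w)
          close with consecutive E eq
          ... | inj₁ up   = ≤-reflexive up , ≤-trans (≤-trans (n≤1+n _) (≤-reflexive (sym up))) (n≤1+n _)
          ... | inj₂ down = ≤-trans (≤-trans (n≤1+n _) (≤-reflexive (sym down))) (n≤1+n _) , ≤-reflexive down

        tame-traversed : ∀ {tr i p} → All Tame tr → Traversed graph tr i p → Tame (i , p)
        tame-traversed (t ∷ _) (here (inj₁ (from , to))) =
          subst₂ (λ x y → Close (known-layer (dec x)) (known-layer (dec y))) from to t
        tame-traversed (t ∷ _) (here (inj₂ (from , to))) =
          swap (subst₂ (λ x y → Close (known-layer (dec x)) (known-layer (dec y))) from to t)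
        tame-traversed (_ ∷ ts) (there t) = tame-traversed ts t

        beyond : D ≤ layer v → suc D ≤ D
        beyond D≤layer with p′ , runs′ , _ , step ← take {p} takes
                       with ℓ , ℓ≤D , w ← dist (suc τ) τ<T _ runs′ = begin
          suc D                                         ≡⟨ cong known-layer hidden-end ⟨
          known-layer (dec (nbr graph (pos conf) p′))   ≤⟨ walk-bound-start graph (known-layer ∘ dec)
                                                             (tame-traversed (All.++⁺ (All.map known-tame known) (last-tame ∷ []))) w ⟩
          ℓ + known-layer (dec source)                  ≡⟨ cong (λ x → ℓ + known-layer x) (dec-enc (core s)) ⟩
          ℓ + layer s                                   ≡⟨ trans (cong (ℓ +_) layer-s) (+-identityʳ ℓ) ⟩
          ℓ                                             ≤⟨ ℓ≤D ⟩
          D                                             ∎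
          where
          open ≤-Reasoning
          hidden-end : dec (nbr graph (pos conf) p′) ≡ hidden p
          hidden-end = trans step (cong (λ t → arrive t p) free)
          last-tame : Tame (pos conf , p′)
          last-tame = subst₂ (λ x y → Close (known-layer x) (known-layer y)) (sym at) (sym hidden-end)
            (s≤s D≤layer , ≤-trans (layer≤D v) (≤-trans (n≤1+n D) (n≤1+n _)))

      -- Halting times are unique, so the given halted configuration is the one supplied by
      -- `Solves`.
      halted-explored : Solves D A graph source → ∀ {T cT} → exec T ≡ just cT → Halts cT → Explored cT
      halted-explored (T′ , cT′ , ex′ , halts′ , explored′ , _) {T} ex halts =
        subst Explored (just-injective (trans (sym ex′) (trans (cong exec T′≡T) ex))) explored′
        where
        T′≡T : T′ ≡ T
        T′≡T = ≤-antisym (halted-last ex halts ex′) (halted-last ex′ halts′ ex)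

      -- Every edge is either among the `M` discovered ones or traversed in the last `j` moves, so
      -- there are at most `M + j` edges against `τ + j` moves. The penalty is thus at least
      -- `τ - M`, and `2 * M ≤ τ + D`.
      penalty-bound : ∀ {τ v h} → Play E τ v h → 2 * length (edges E) ≤ τ + layer v → Solves D A graph source →
        ∀ T cT → exec T ≡ just cT → Halts cT → length (edges E) ≤ penalty cT + D
      penalty-bound {τ} {v} π long solves T cT ex halts
        with rest , trav≡ , len ← exec-extends (T ∸ τ) {τ} (Tracks.runs (tracks π))
               (trans (cong exec (m∸n+n≡m (halted-last {T} {σ = τ} ex halts (Tracks.runs (tracks π))))) ex) = +-cancelˡ-≤ M _ _ (begin
        M + M                        ≡⟨ cong (M +_) (+-identityʳ M) ⟨
        2 * M                        ≤⟨ long ⟩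
        τ + layer v                  ≤⟨ +-monoʳ-≤ τ (layer≤D v) ⟩
        τ + D                        ≤⟨ +-monoˡ-≤ D (+-cancelˡ-≤ j _ _ excess) ⟩
        M + penalty cT + D           ≡⟨ +-assoc M _ D ⟩
        M + (penalty cT + D)         ∎)
        where
        open ≤-Reasoning
        open Tracks (tracks π)

        M j : ℕ
        M = length (edges E)
        j = T ∸ τ

        encode : Fin c × Fin c → Fin size × Fin size
        encode (a , b) = enc (core a) , enc (core b)

        cover : List (Fin size × Fin size)
        cover = map encode (edges E) ++ map (endpoints graph) rest

        decoded : ∀ {i a} → dec i ≡ core a → enc (core a) ≡ i
        decoded {i} eq = trans (cong enc (sym eq)) (enc-dec i)

        known-covered : ∀ {a b i k} → dec i ≡ core a → dec k ≡ core b → Covered (edges E) a b →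
          Covered (map encode (edges E)) i k
        known-covered eqi eqk cov = map⁺ (Any.map
          (λ { (inj₁ (refl , refl)) → inj₁ (decoded eqi , decoded eqk)
             ; (inj₂ (refl , refl)) → inj₂ (decoded eqk , decoded eqi) }) cov)

        swap-covered : ∀ {X : Set} {es : List (X × X)} {a b} → Covered es a b → Covered es b a
        swap-covered = Any.map (λ { (inj₁ x) → inj₂ x ; (inj₂ y) → inj₁ y })

        traversed-known : ∀ {tr i p} → All Known tr → Traversed graph tr i p →
          Covered (map encode (edges E)) i (nbr graph i p)
        traversed-known ((_ , _ , _ , from , to , eq) ∷ _) (here (inj₁ (refl , nbr≡))) =
          known-covered from (trans (cong dec (sym nbr≡)) to) (covered E eq)
        traversed-known ((_ , _ , _ , from , to , eq) ∷ _) (here (inj₂ (v≡ , nbr≡))) =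
          swap-covered (known-covered (trans (cong dec (sym v≡)) from) (trans (cong dec (sym nbr≡)) to) (covered E eq))
        traversed-known (_ ∷ ks) (there t) = traversed-known ks t

        all-covered : ∀ i p → Covered cover i (nbr graph i p)
        all-covered i p with ++⁻ (trav conf) (subst (λ tr → Traversed graph tr i p) trav≡ (halted-explored solves {T} ex halts i p))
        ... | inj₁ before = ++⁺ˡ (traversed-known known before)
        ... | inj₂ after  = ++⁺ʳ (map encode (edges E)) (traversed⇒covered graph after)

        numEdges≤ : numEdges graph ≤ M + j
        numEdges≤ = ≤-trans (numEdges-cover graph cover all-covered) (≤-reflexive
          (trans (length-++ (map encode (edges E)))
                 (cong₂ _+_ (length-map encode (edges E)) (trans (length-map (endpoints graph) rest) len))))

        excess : j + τ ≤ j + (M + penalty cT)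
        excess = begin
          j + τ                                ≡⟨ +-comm j τ ⟩
          τ + j                                ≡⟨ cong₂ _+_ duration len ⟨
          length (trav conf) + length rest     ≡⟨ trans (cong length trav≡) (length-++ (trav conf)) ⟨
          length (trav cT)                     ≤⟨ m≤n+m∸n (length (trav cT)) (numEdges graph) ⟩
          numEdges graph + penalty cT          ≤⟨ +-monoˡ-≤ (penalty cT) numEdges≤ ⟩
          M + j + penalty cT                   ≡⟨ cong (_+ penalty cT) (+-comm M j) ⟩
          j + M + penalty cT                   ≡⟨ +-assoc j M _ ⟩
          j + (M + penalty cT)                 ∎

  -- The game, one discovery after another.

  module Strategy (r D : ℕ) (6≤r : 6 ≤ r) (solves : SolvesAll r D A)
    (layer≤D : ∀ v → layer v ≤ D) (layer-s : layer s ≡ 0)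
    (rows : ∀ i → i < D → ∃ λ ws → Unique ws × All (λ w → layer w ≡ suc i) ws × d + d ≤ length ws) where

    instance-with-tail : ∀ E → 2 * length (edges E) < d * d → ∀ b {e} →
      (Free E s × b ≡ 0) ⊎ (¬ Free E s × b ≡ 1) → 2 + b + e ≡ r →
      ∃ λ e → e ≤ r × InI r (Completion.graph E e) (Completion.source E e)
    instance-with-tail E sparse b {e} spec refl =
      e , m≤n+m e (2 + b) , Completion.instance-of E e (Counting.nearFree E sparse) b spec 6≤r

    -- The tail has length `r - 2` or `r - 3`, according to whether the source still has an
    -- unexplored port.
    instance-exists : ∀ E → 2 * length (edges E) < d * d →
      ∃ λ e → e ≤ r × InI r (Completion.graph E e) (Completion.source E e)
    instance-exists E sparse with free? E s
    ... | yes free = instance-with-tail E sparse 0 (inj₁ (free , refl)) (m+[n∸m]≡n (≤-trans (m≤m+n 2 4) 6≤r))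
    ... | no full  = instance-with-tail E sparse 1 (inj₂ (full , refl)) (m+[n∸m]≡n (≤-trans (m≤m+n 3 3) 6≤r))

    some-free : ∀ E → 2 * length (edges E) < d * d → ∃ (Free E)
    some-free E sparse with free? E s
    ... | yes free = s , free
    ... | no full  = let _ , w , _ , free = Counting.nearFree E sparse s full in w , free

    record State (M : ℕ) : Set where
      field
        {E}   : Exploration
        {τ}   : ℕ
        {v}   : Fin c
        {h}   : List Step
        play  : Play E τ v h
        count : length (edges E) ≡ M
        -- Each edge is discovered by a move to the next layer, and every other move changes the layer by one.
        long  : 2 * length (edges E) ≤ τ + layer v

    initial : State 0
    initial = record { E = empty ; play = start ; count = refl ; long = z≤n }
      where
      empty : Exploration
      empty = record
        { target = λ _ _ → nothing
        ; edges = []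
        ; target-injective = λ ()
        ; target-symmetric = λ ()
        ; consecutive = λ ()
        ; covered = λ ()
        }

    module _ {M} (sM : State M) (e : ℕ) where
      open State sM
      open Completion E e
      open Simulation E e

      next-frontier : Solves D A graph source → ∃ (Free E) → ∃ λ T → Σ (Frontier T) λ fr → layer (Frontier.v fr) < D
      next-frontier (T , cT , ex , halts , explored , dist) free = T , fr , frontier-layer D layer≤D layer-s dist fr
        where
        τ≤1+T : τ ≤ suc T
        τ≤1+T = m≤n⇒m≤1+n (halted-last {T} {σ = τ} ex halts (Tracks.runs (tracks play)))
        fr : Frontier T
        fr = frontier ex halts explored free play long (suc T ∸ τ) (m+[n∸m]≡n τ≤1+T)

      -- The unexplored port is answered by a fresh vertex one layer up. One more move and one more
      -- layer raise `τ + layer` by two, matching the new edge on the left of `long`.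
      discover-at : ∀ {T} → 2 * length (edges E) < d * d → (fr : Frontier T) → layer (Frontier.v fr) < D → State (suc M)
      discover-at sparse fr v<D with ws , ws! , next , wide ← rows _ v<D
        with w , w∈ , (q , wq-free) , far ← Counting.fresh-neighbour E sparse (Frontier.v fr) ws! wide = record
          { E = grown
          ; play = move (play-mono keeps F.play) F.takes forward backward
          ; count = cong suc count
          ; long = begin
              2 * suc (length (edges E))         ≡⟨ *-suc 2 (length (edges E)) ⟩
              2 + 2 * length (edges E)           ≤⟨ +-monoʳ-≤ 2 F.long ⟩
              2 + (F.τ + layer F.v)              ≡⟨ cong suc (+-suc F.τ (layer F.v)) ⟨
              suc F.τ + suc (layer F.v)          ≡⟨ cong (suc F.τ +_) up ⟨
              suc F.τ + layer w                  ∎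
          }
          where
          open ≤-Reasoning
          module F = Frontier fr
          up : layer w ≡ suc (layer F.v)
          up = All.lookup next w∈
          open Growth E F.free wq-free up far

    sparse-state : ∀ {M} → 2 * M < d * d → (sM : State M) → 2 * length (edges (State.E sM)) < d * d
    sparse-state lt sM = subst (λ x → 2 * x < d * d) (sym (State.count sM)) lt

    -- The completion serves only to force the agent to an unexplored port. The play found there
    -- does not mention it, so it is discarded and the next round may choose another.
    discover : ∀ {M} → 2 * M < d * d → State M → State (suc M)
    discover lt sM =
      let sparse = sparse-state lt sM
          e , _ , inI = instance-exists (State.E sM) sparse
          _ , fr , v<D = next-frontier sM e (solves _ _ inI) (some-free (State.E sM) sparse)
      in discover-at sM e sparse fr v<D

    state : ∀ M → 2 * M < d * d → State M
    state zero    _  = initial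
    state (suc M) lt = discover lt′ (state M lt′)
      where
      lt′ : 2 * M < d * d
      lt′ = ≤-trans (s≤s (*-monoʳ-≤ 2 (n≤1+n M))) lt

    costly : ∀ M → 2 * M < d * d → Σ PortGraph λ G → Σ (Fin (n G)) λ s →
      InI r G s × (∃ λ e → e ≤ r × n G ≡ c + (d + suc e)) ×
      (∀ T c → Run.exec A G s T ≡ just c → Run.Halts A G s c → M ≤ Run.penalty A G s c + D)
    costly M lt with state M lt
    ... | sM with e , e≤r , inI ← instance-exists (State.E sM) (sparse-state lt sM) =
      Completion.graph (State.E sM) e , Completion.source (State.E sM) e , inI , (e , e≤r , refl) , λ T cT ex halts →
      ≤-trans (≤-reflexive (sym (State.count sM)))
        (Simulation.penalty-bound (State.E sM) e D layer≤D layer-s (State.play sM) (State.long sM)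
          (solves _ _ inI) T cT ex halts)

-- Choice of the parameters and the final estimate.

theorem1 : (r D : ℕ) → 6 ≤ r → r ≤ D → (A : Algorithm) → SolvesAll r D A →
    (k : ℕ) → 1 < k →
    Σ PortGraph λ G → Σ (Fin (n G)) λ s →
    InI r G s × k ≤ n G ×
    (∀ T c → Run.exec A G s T ≡ just c → Run.Halts A G s c →
    n G * n G ≤ Run.penalty A G s c * ((16 * (2 * D + 3)) * (16 * (2 * D + 3))))
theorem1 r D 6≤r r≤D A solves k _ = conclude (costly (m * m + D) sparse)
  where
  m d N c : ℕ
  -- Exceeding `k` gives enough vertices; exceeding `D` makes `D` negligible against `m * m` and the
  -- tail, of length at most `r ≤ D`, negligible against `m`. A layer has `d + d` vertices, as
  -- `fresh-neighbour` demands.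
  m = suc (k + D)
  d = m + m
  N = d + d
  c = suc D * N

  layer : Fin c → ℕ
  layer v = toℕ (proj₁ (remQuot {suc D} N v))

  layer-combine : (i : Fin (suc D)) (j : Fin N) → layer (combine i j) ≡ toℕ i
  layer-combine i j = cong (toℕ ∘ proj₁) (remQuot-combine i j)

  rows : ∀ i → i < D → ∃ λ ws → Unique ws × All (λ w → layer w ≡ suc i) ws × d + d ≤ length ws
  rows i i<D = tabulate (combine row) ,
    Unique.tabulate⁺ {f = combine row} (λ {j} {l} → combine-injectiveʳ row j row l) ,
    All.tabulate⁺ {f = combine row} (λ j → trans (layer-combine row j) (toℕ-fromℕ< (s≤s i<D))) ,
    ≤-reflexive (sym (length-tabulate (combine row)))
    where
    row : Fin (suc D)
    row = fromℕ< (s≤s i<D)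

  origin : Fin c
  origin = combine {suc D} {N} zero zero

  open Adversary c d layer origin A
  open Strategy r D 6≤r solves (λ v → toℕ≤pred[n] (proj₁ (remQuot {suc D} N v))) (layer-combine zero zero) rows

  D<m : D < m
  D<m = s≤s (m≤n+m D k)

  sparse : 2 * (m * m + D) < d * d
  sparse = begin-strict
    2 * (m * m + D)             <⟨ *-monoʳ-< 2 (+-monoʳ-< (m * m) (<-≤-trans D<m (m≤m*n m m))) ⟩
    2 * (m * m + m * m)         ≡⟨ double-square m ⟩
    d * d                       ∎
    where
    open ≤-Reasoning
    double-square : ∀ m → 2 * (m * m + m * m) ≡ (m + m) * (m + m)
    double-square = solve-∀

  K : ℕ
  K = 16 * (2 * D + 3)

  conclude : (Σ PortGraph λ G → Σ (Fin (n G)) λ s →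
      InI r G s × (∃ λ e → e ≤ r × n G ≡ c + (d + suc e)) ×
      (∀ T c → Run.exec A G s T ≡ just c → Run.Halts A G s c → m * m + D ≤ Run.penalty A G s c + D)) → _
  conclude (G , s , inI , (e , e≤r , n≡) , bound) = G , s , inI , k≤n , λ T cT ex halts → begin
    n G * n G                                  ≤⟨ *-mono-≤ n≤Km n≤Km ⟩
    K * m * (K * m)                            ≡⟨ rearrange K m ⟩
    -- The `D` discoveries beyond `m * m` cancel the loss of `D` in the penalty bound.
    m * m * (K * K)                            ≤⟨ *-monoˡ-≤ (K * K) (+-cancelʳ-≤ D _ _ (bound T cT ex halts)) ⟩
    Run.penalty A G s cT * (K * K)             ∎
    where
    open ≤-Reasoning
    k≤n : k ≤ n G
    k≤n = begin
      k                  ≤⟨ m≤m+n k D ⟩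
      k + D              ≤⟨ n≤1+n (k + D) ⟩
      m                  ≤⟨ m≤m+n m m ⟩
      d                  ≤⟨ m≤m+n d (suc e) ⟩
      d + suc e          ≤⟨ m≤n+m (d + suc e) c ⟩
      c + (d + suc e)    ≡⟨ n≡ ⟨
      n G                ∎

    rearrange : ∀ K m → K * m * (K * m) ≡ m * m * (K * K)
    rearrange = solve-∀

    -- The core has `4 * m` vertices in each of `suc D` layers, there are `2 * m` hidden ones, and
    -- at most `m` on the tail; the last summand on the left is the slack in the constant 16.
    expand : ∀ D m → suc D * (m + m + (m + m)) + (m + m + m) + (28 * D * m + 41 * m) ≡ 16 * (2 * D + 3) * m
    expand = solve-∀

    n≤Km : n G ≤ K * m
    n≤Km = begin
      n G                                    ≡⟨ n≡ ⟩
      c + (d + suc e)                        ≤⟨ +-monoʳ-≤ c (+-monoʳ-≤ d (≤-trans (s≤s (≤-trans e≤r r≤D)) D<m)) ⟩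
      c + (d + m)                            ≤⟨ m≤m+n (c + (d + m)) (28 * D * m + 41 * m) ⟩
      c + (d + m) + (28 * D * m + 41 * m)    ≡⟨ expand D m ⟩
      K * m                                  ∎
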